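{- Let $G$ be a connected graph of order $n$, minimum degree $\delta$ and maximum degree $\Delta$. Then there exists a spanning tree $T$ of $G$ with \[ \rho(T) \leq \frac{3(n^2-\Delta^2)}{2(n-1)(\delta+1)} + 7. \]
   Context: For a connected graph $H$ of order $n \ge 2$ and a vertex $v$, the average distance of $v$ is $\overline{\sigma}(v,H) = \frac{1}{n-1}\sum_{u \in V(H)} d_H(v,u)$, where $d_H$ is the shortest-path distance in $H$. The remoteness $\rho(H)$ is the maximum of $\overline{\sigma}(v,H)$ over all vertices $v$ of $H$. -}

module Defs where

open import Data.Nat as ℕ using (ℕ; zero; suc; _∸_; _≤_; s≤s; z≤n; NonZero)
open import Data.Bool using (Bool; true; false; if_then_else_)
open import Data.Fin using (Fin)
open import Data.List using (List; []; _∷_; _++_; [_]; length; map; allFin)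
open import Data.Nat.ListAction using (sum)
open import Data.List.Relation.Unary.Unique.Propositional using (Unique)
open import Data.Integer as ℤ using (ℤ; +_)
open import Data.Rational as ℚ using (ℚ)
open import Data.Product using (Σ; _×_; ∃)
open import Data.Empty using (⊥)
open import Data.Unit using (⊤)
open import Relation.Binary.PropositionalEquality using (_≡_)
open import Relation.Nullary using (¬_)

record Graph (n : ℕ) : Set where
  field
    adj    : Fin n → Fin n → Bool
    sym    : ∀ u v → adj u v ≡ adj v u
    irrefl : ∀ v → adj v v ≡ false
open Graph public

module _ {n : ℕ} (G : Graph n) where

  Adj : Fin n → Fin n → Set
  Adj u v = adj G u v ≡ true

  data Walk : Fin n → Fin n → ℕ → Set where
    here : ∀ {u} → Walk u u 0
    step : ∀ {u w v k} → Adj u w → Walk w v k → Walk u v (suc k)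

  Connected : Set
  Connected = ∀ u v → ∃ λ k → Walk u v k

  Chain : List (Fin n) → Set
  Chain []           = ⊤
  Chain (x ∷ [])     = ⊤
  Chain (x ∷ y ∷ xs) = Adj x y × Chain (y ∷ xs)

  IsCycle : List (Fin n) → Set
  IsCycle []       = ⊥
  IsCycle (x ∷ xs) = (2 ≤ length xs) × Unique (x ∷ xs) × Chain (x ∷ xs ++ [ x ])

  Acyclic : Set
  Acyclic = ∀ cs → ¬ IsCycle cs

  IsTree : Set
  IsTree = Connected × Acyclic

  degree : Fin n → ℕ
  degree v = sum (map (λ u → if adj G v u then 1 else 0) (allFin n))

  IsMinDegree : ℕ → Set
  IsMinDegree δ = (∀ v → δ ≤ degree v) × ∃ (λ v → degree v ≡ δ)

  IsMaxDegree : ℕ → Set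
  IsMaxDegree Δ = (∀ v → degree v ≤ Δ) × ∃ (λ v → degree v ≡ Δ)

  IsDistance : Fin n → Fin n → ℕ → Set
  IsDistance u v k = Walk u v k × (∀ m → Walk u v m → k ≤ m)

_⊆ᴳ_ : ∀ {n} → Graph n → Graph n → Set
T ⊆ᴳ G = ∀ u v → Adj T u v → Adj G u v

IsSpanningTree : ∀ {n} → Graph n → Graph n → Set
IsSpanningTree T G = (T ⊆ᴳ G) × IsTree T

nonZero-pred : ∀ {n} → 2 ≤ n → NonZero (n ∸ 1)
nonZero-pred (s≤s (s≤s _)) = _

totalDist : ∀ {n} → (Fin n → Fin n → ℕ) → Fin n → ℕ
totalDist {n} d v = sum (map (d v) (allFin n))

avgDist : ∀ {n} → 2 ≤ n → (Fin n → Fin n → ℕ) → Fin n → ℚ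
avgDist {n} h d v = ℚ._/_ (+ totalDist d v) (n ∸ 1) {{nonZero-pred h}}

-- remoteness ρ ≤ q  ⇔  every vertex has average distance ≤ q
-- (ρ is the maximum of avgDist over vertices).
-- the bound  3(n²−Δ²) / (2(n−1)(δ+1)) + 7
nonZero-den : ∀ {n} → 2 ≤ n → (δ : ℕ) → NonZero (2 ℕ.* (n ∸ 1) ℕ.* suc δ)
nonZero-den (s≤s (s≤s _)) δ = _

bound : ∀ (n : ℕ) → 2 ≤ n → ℕ → ℕ → ℚ
bound n h δ Δ =
  ℚ._+_ (ℚ._/_ (+ 3 ℤ.* (+ (n ℕ.* n) ℤ.- + (Δ ℕ.* Δ)))
               (2 ℕ.* (n ∸ 1) ℕ.* suc δ) {{nonZero-den h δ}})
        (ℚ._/_ (+ 7) 1)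

{-# OPTIONS --safe #-}

-- Starting from a vertex r of maximum degree, repeatedly choose a vertex a at
-- distance exactly 3 from the set A of centres chosen so far. The closed
-- neighbourhoods N[a] are disjoint stars, and joining each new star to the
-- earlier ones by one edge gives a tree in which consecutive centres are at
-- distance 3. When the process stops every other vertex has a neighbour in
-- some star, and is attached there as a leaf. So d_T(u,w) ≤ 4 + 3 f(w), where
-- f(w) is the distance of the clusters of u and w in the tree of clusters.
-- Every level of f below a nonempty one contains at least δ+1 vertices, whence
-- (δ+1) f(w) ≤ #{z : f z < f w}. Summing over w and splitting all n² ordered
-- pairs (w,z) according to f z < f w, f z > f w or f z = f w, where the level
-- of r contributes (Δ+1)² pairs of the last kind, we obtain
-- 2(δ+1) Σ f + (Δ+1)² ≤ n².

module Submission where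

open import Defs
open import Data.Nat using (ℕ; _≤_)
open import Data.Fin using (Fin)
open import Data.Product using (Σ; _×_)
open import Data.Rational using (ℚ) renaming (_≤_ to _≤ℚ_)

open import Data.Nat using (zero; suc; _+_; _*_; _<_; z≤n; s≤s; _<?_)
import Data.Nat as ℕ
import Data.Nat.Properties as ℕₚ
open import Data.Nat.ListAction using (sum)
open import Data.Nat.Tactic.RingSolver using (solve-∀)
import Data.Integer as ℤ
open import Data.Integer using (+_)
import Data.Integer.Properties as ℤₚ
import Data.Integer.Tactic.RingSolver as ℤ-Solver
import Data.Rational as ℚ
open import Data.Rational using (toℚᵘ)
import Data.Rational.Properties as ℚₚ
open import Data.Rational.Unnormalised as ℚᵘ using (mkℚᵘ; *≤*)
import Data.Rational.Unnormalised.Properties as ℚᵘₚ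
open import Data.Bool using (true; false; if_then_else_)
import Data.Bool.Properties as Boolₚ
open import Data.Fin.Properties using (_≟_; any?)
open import Data.List using (List; []; _∷_; _++_; [_]; map; allFin; length)
open import Data.List.Properties using (length-tabulate; map-cong)
open import Data.List.Membership.Propositional using (_∈_)
open import Data.List.Membership.Propositional.Properties using (∈-allFin)
open import Data.List.Relation.Unary.Any using (here; there)
open import Data.List.Relation.Unary.All as All using ([]; _∷_)
open import Data.List.Relation.Unary.All.Properties using (++⁺)
open import Data.List.Relation.Unary.AllPairs using ([]; _∷_)
open import Data.List.Relation.Unary.Unique.Propositional using (Unique)
open import Data.Product using (∃; _,_; proj₁; proj₂)
open import Data.Sum using (_⊎_; inj₁; inj₂; swap)
open import Data.Empty using (⊥-elim)
open import Data.Unit using (⊤; tt)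
open import Function using (_∘_; mk⇔)
open import Relation.Binary using (tri<; tri≈; tri>)
open import Relation.Binary.PropositionalEquality as ≡ using (_≡_; _≢_; refl; cong; cong₂; subst; subst₂; trans)
open import Relation.Nullary using (¬_; Dec; yes; no; does)
open import Relation.Nullary.Decidable using (_×-dec_; _⊎-dec_; ¬?; map′; dec-true; dec-false; does-⇔)

private
  variable
    n : ℕ

-- Finite sums and counting

indicator : ∀ {A : Set} → Dec A → ℕ
indicator a? = if does a? then 1 else 0

indicator-yes : ∀ {A : Set} (a? : Dec A) → A → indicator a? ≡ 1
indicator-yes (yes _) _ = refl
indicator-yes (no ¬a) a = ⊥-elim (¬a a)

indicator-no : ∀ {A : Set} (a? : Dec A) → ¬ A → indicator a? ≡ 0
indicator-no (yes a) ¬a = ⊥-elim (¬a a)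
indicator-no (no _)  _  = refl

indicator-mono : ∀ {A B : Set} (a? : Dec A) (b? : Dec B) → (A → B) → indicator a? ≤ indicator b?
indicator-mono (yes a) b? f rewrite indicator-yes b? (f a) = ℕₚ.≤-refl
indicator-mono (no _)  b? f = z≤n

module _ {A : Set} where

  sum-mono : ∀ (xs : List A) {f g : A → ℕ} → (∀ x → f x ≤ g x) → sum (map f xs) ≤ sum (map g xs)
  sum-mono []       f≤g = z≤n
  sum-mono (x ∷ xs) f≤g = ℕₚ.+-mono-≤ (f≤g x) (sum-mono xs f≤g)

  sum-+ : ∀ (xs : List A) (f g : A → ℕ) →
          sum (map (λ x → f x + g x) xs) ≡ sum (map f xs) + sum (map g xs)
  sum-+ []       f g = refl
  sum-+ (x ∷ xs) f g rewrite sum-+ xs f g = interchange (f x) (g x) (sum (map f xs)) (sum (map g xs))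
    where
    interchange : ∀ a b c d → a + b + (c + d) ≡ a + c + (b + d)
    interchange = solve-∀

  sum-* : ∀ (xs : List A) k (f : A → ℕ) → sum (map (λ x → k * f x) xs) ≡ k * sum (map f xs)
  sum-* []       k f = ≡.sym (ℕₚ.*-zeroʳ k)
  sum-* (x ∷ xs) k f rewrite sum-* xs k f = ≡.sym (ℕₚ.*-distribˡ-+ k (f x) _)

  sum-const : ∀ (xs : List A) k → sum (map (λ _ → k) xs) ≡ length xs * k
  sum-const []       k = refl
  sum-const (x ∷ xs) k = cong (_+_ k) (sum-const xs k)

  ∈⇒≤sum : ∀ {xs : List A} (f : A → ℕ) {x} → x ∈ xs → f x ≤ sum (map f xs)
  ∈⇒≤sum f (here refl) = ℕₚ.m≤m+n _ _
  ∈⇒≤sum f (there x∈xs) = ℕₚ.≤-trans (∈⇒≤sum f x∈xs) (ℕₚ.m≤n+m _ _)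

  sum-mono-< : ∀ {xs : List A} {f g : A → ℕ} {x} → (∀ y → f y ≤ g y) → x ∈ xs → f x < g x →
               sum (map f xs) < sum (map g xs)
  sum-mono-< {_ ∷ xs} f≤g (here refl) f<g = ℕₚ.+-mono-<-≤ f<g (sum-mono xs f≤g)
  sum-mono-< f≤g (there {x = y} x∈xs) f<g = ℕₚ.+-mono-≤-< (f≤g y) (sum-mono-< f≤g x∈xs f<g)

sum-swap : ∀ {A B : Set} (xs : List A) (ys : List B) (f : A → B → ℕ) →
           sum (map (λ x → sum (map (f x) ys)) xs) ≡ sum (map (λ y → sum (map (λ x → f x y) xs)) ys)
sum-swap []       ys f = ≡.sym (trans (sum-const ys 0) (ℕₚ.*-zeroʳ (length ys)))
sum-swap (x ∷ xs) ys f rewrite sum-swap xs ys f = ≡.sym (sum-+ ys (f x) _)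

∑ : (Fin n → ℕ) → ℕ
∑ {n} f = sum (map f (allFin n))

∑-mono : {f g : Fin n → ℕ} → (∀ x → f x ≤ g x) → ∑ f ≤ ∑ g
∑-mono = sum-mono (allFin _)

∑-const : ∀ n k → ∑ {n} (λ _ → k) ≡ n * k
∑-const n k = trans (sum-const (allFin n) k) (cong (_* k) (length-tabulate {n = n} (λ z → z)))

count : {P : Fin n → Set} → (∀ x → Dec (P x)) → ℕ
count P? = ∑ (λ x → indicator (P? x))

-- Counting pairs of vertices by level

module Levels (f : Fin n → ℕ) (m : ℕ)
  (pred : ∀ {w k} → f w ≡ suc k → ∃ λ w′ → f w′ ≡ k)
  (level : ∀ w → m ≤ count (λ z → f z ℕₚ.≟ f w)) where

  below : ℕ → ℕ
  below k = count (λ z → f z <? k)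

  below-suc : ∀ k → below k + count (λ z → f z ℕₚ.≟ k) ≤ below (suc k)
  below-suc k = subst (_≤ below (suc k)) (sum-+ (allFin n) _ _) (∑-mono pointwise)
    where
    pointwise : ∀ z → indicator (f z <? k) + indicator (f z ℕₚ.≟ k) ≤ indicator (f z <? suc k)
    pointwise z with ℕₚ.<-cmp (f z) k
    ... | tri< lt ne _ rewrite indicator-yes (f z <? k) lt | indicator-no (f z ℕₚ.≟ k) ne
                             | indicator-yes (f z <? suc k) (ℕₚ.m≤n⇒m≤1+n lt) = ℕₚ.≤-refl
    ... | tri≈ nlt eq _ rewrite indicator-no (f z <? k) nlt | indicator-yes (f z ℕₚ.≟ k) eq
                              | indicator-yes (f z <? suc k) (s≤s (ℕₚ.≤-reflexive eq)) = ℕₚ.≤-refl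
    ... | tri> nlt ne _ rewrite indicator-no (f z <? k) nlt | indicator-no (f z ℕₚ.≟ k) ne = z≤n

  -- Descending from `w` with `pred` meets every level under `k`, and each such level contributes
  -- `m` vertices.
  below-level : ∀ k {w} → f w ≡ k → m * k ≤ below k
  below-level zero    _  rewrite ℕₚ.*-zeroʳ m = z≤n
  below-level (suc k) eq with pred eq
  ... | w′ , eq′ = begin
    m * suc k                              ≡⟨ ℕₚ.*-suc m k ⟩
    m + m * k                              ≡⟨ ℕₚ.+-comm m _ ⟩
    m * k + m                              ≤⟨ ℕₚ.+-mono-≤ (below-level k eq′) (subst (λ j → m ≤ count (λ z → f z ℕₚ.≟ j)) eq′ (level w′)) ⟩
    below k + count (λ z → f z ℕₚ.≟ k)     ≤⟨ below-suc k ⟩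
    below (suc k)                          ∎
    where open ℕₚ.≤-Reasoning

  lower upper same : Fin n → Fin n → ℕ
  lower w z = indicator (f z <? f w)
  upper w z = lower z w
  same  w z = indicator (f z ℕₚ.≟ f w)

  trichotomy : ∀ w z → lower w z + upper w z + same w z ≤ 1
  trichotomy w z with ℕₚ.<-cmp (f z) (f w)
  ... | tri< a b c rewrite indicator-yes (f z <? f w) a | indicator-no (f w <? f z) c | indicator-no (f z ℕₚ.≟ f w) b = ℕₚ.≤-refl
  ... | tri≈ a b c rewrite indicator-no (f z <? f w) a | indicator-no (f w <? f z) c | indicator-yes (f z ℕₚ.≟ f w) b = ℕₚ.≤-refl
  ... | tri> a b c rewrite indicator-no (f z <? f w) a | indicator-yes (f w <? f z) c | indicator-no (f z ℕₚ.≟ f w) b = ℕₚ.≤-refl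

  ∑∑ : (Fin n → Fin n → ℕ) → ℕ
  ∑∑ g = ∑ (λ w → ∑ (g w))

  ∑∑-+ : ∀ g h → ∑∑ (λ w z → g w z + h w z) ≡ ∑∑ g + ∑∑ h
  ∑∑-+ g h = trans (≡.cong sum (map-cong (λ w → sum-+ (allFin n) (g w) (h w)) (allFin n)))
                   (sum-+ (allFin n) _ _)

  pairs : ∑∑ lower + ∑∑ lower + ∑∑ same ≤ n * n
  pairs = begin
    ∑∑ lower + ∑∑ lower + ∑∑ same
      -- `upper` is the transpose of `lower`, so exchanging the two summations identifies their
      -- totals.
      ≡⟨ cong (λ t → ∑∑ lower + t + ∑∑ same) (sum-swap (allFin n) (allFin n) lower) ⟩
    ∑∑ lower + ∑∑ upper + ∑∑ same
      ≡⟨ cong (_+ ∑∑ same) (∑∑-+ lower upper) ⟨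
    ∑∑ (λ w z → lower w z + upper w z) + ∑∑ same
      ≡⟨ ∑∑-+ _ same ⟨
    ∑∑ (λ w z → lower w z + upper w z + same w z)
      ≤⟨ ∑-mono (λ w → ℕₚ.≤-trans (∑-mono (trichotomy w)) (ℕₚ.≤-reflexive (trans (∑-const n 1) (ℕₚ.*-identityʳ n)))) ⟩
    ∑ (λ (_ : Fin n) → n)
      ≡⟨ ∑-const n n ⟩
    n * n ∎
    where open ℕₚ.≤-Reasoning

  -- The row sum `∑ (lower w)` is `below (f w)` by definition, so `below-level` applies row by row.
  ∑≤lower : m * ∑ f ≤ ∑∑ lower
  ∑≤lower = subst (_≤ ∑∑ lower) (sum-* (allFin n) m f) (∑-mono (λ w → below-level (f w) refl))

  -- Only the rows `w` in the level of `r` are kept: there are at least `M` of them, and each has at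
  -- least `M` entries equal to one.
  square≤same : ∀ {M} r → M ≤ count (λ z → f z ℕₚ.≟ f r) → M * M ≤ ∑∑ same
  square≤same {M} r M≤ = begin
    M * M                                            ≤⟨ ℕₚ.*-monoʳ-≤ M M≤ ⟩
    M * count (λ z → f z ℕₚ.≟ f r)                   ≡⟨ sum-* (allFin n) M _ ⟨
    ∑ (λ w → M * indicator (f w ℕₚ.≟ f r))           ≤⟨ ∑-mono pointwise ⟩
    ∑∑ same                                          ∎
    where
    open ℕₚ.≤-Reasoning
    pointwise : ∀ w → M * indicator (f w ℕₚ.≟ f r) ≤ ∑ (same w)
    pointwise w with f w ℕₚ.≟ f r
    ... | yes eq rewrite indicator-yes (f w ℕₚ.≟ f r) eq | ℕₚ.*-identityʳ M | eq = M≤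
    ... | no  ne rewrite indicator-no (f w ℕₚ.≟ f r) ne | ℕₚ.*-zeroʳ M = z≤n

  level-bound : ∀ {M} r → M ≤ count (λ z → f z ℕₚ.≟ f r) → 2 * (m * ∑ f) + M * M ≤ n * n
  level-bound {M} r M≤ = begin
    2 * (m * ∑ f) + M * M            ≡⟨ cong (_+ M * M) (double (m * ∑ f)) ⟩
    m * ∑ f + m * ∑ f + M * M        ≤⟨ ℕₚ.+-mono-≤ (ℕₚ.+-mono-≤ ∑≤lower ∑≤lower) (square≤same r M≤) ⟩
    ∑∑ lower + ∑∑ lower + ∑∑ same    ≤⟨ pairs ⟩
    n * n                            ∎
    where
    open ℕₚ.≤-Reasoning
    double : ∀ a → 2 * a ≡ a + a
    double = solve-∀

-- Walks and distances

module _ (G : Graph n) where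

  -- An upper bound in place of an exact length lets a route be estimated uniformly even when some
  -- of its edges degenerate, as when a vertex is its own centre.
  Within : ℕ → Fin n → Fin n → Set
  Within k u v = ∃ λ j → j ≤ k × Walk G u v j

  adj-sym : ∀ {u v} → Adj G u v → Adj G v u
  adj-sym {u} {v} e = trans (sym G v u) e

  adj⇒≢ : ∀ {u v} → Adj G u v → u ≢ v
  adj⇒≢ {u} e refl with trans (≡.sym e) (irrefl G u)
  ... | ()

module _ {G : Graph n} where

  within-refl : ∀ {k u} → Within G k u u
  within-refl = 0 , z≤n , here

  within-edge : ∀ {u v} → Adj G u v → Within G 1 u v
  within-edge e = 1 , ℕₚ.≤-refl , step e here

  walk-++ : ∀ {u v w j k} → Walk G u v j → Walk G v w k → Walk G u w (j + k)
  walk-++ here       q = q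
  walk-++ (step e p) q = step e (walk-++ p q)

  within-trans : ∀ {u v w j k} → Within G j u v → Within G k v w → Within G (j + k) u w
  within-trans (_ , i≤j , p) (_ , l≤k , q) = _ , ℕₚ.+-mono-≤ i≤j l≤k , walk-++ p q

  walk-reverse : ∀ {u v k} → Walk G u v k → Walk G v u k
  walk-reverse here = here
  walk-reverse {u} (step {k = k} e p) =
    subst (Walk G _ u) (ℕₚ.+-comm k 1) (walk-++ (walk-reverse p) (step (adj-sym G e) here))

  within-sym : ∀ {u v k} → Within G k u v → Within G k v u
  within-sym (j , j≤k , p) = j , j≤k , walk-reverse p

  distance-within : ∀ {u v d k} → IsDistance G u v d → Within G k u v → d ≤ k
  distance-within (_ , minimal) (j , j≤k , p) = ℕₚ.≤-trans (minimal j p) j≤k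

walk-mono : {S T : Graph n} → S ⊆ᴳ T → ∀ {u v k} → Walk S u v k → Walk T u v k
walk-mono S⊆T here       = here
walk-mono S⊆T (step e p) = step (S⊆T _ _ e) (walk-mono S⊆T p)

within-mono : {S T : Graph n} → S ⊆ᴳ T → ∀ {u v k} → Within S k u v → Within T k u v
within-mono S⊆T (j , j≤k , p) = j , j≤k , walk-mono S⊆T p

module _ (G : Graph n) where

  walk? : ∀ k u v → Dec (Walk G u v k)
  walk? zero    u v = map′ (λ { refl → here }) (λ { here → refl }) (u ≟ v)
  walk? (suc k) u v = map′ (λ { (_ , e , p) → step e p }) (λ { (step e p) → _ , e , p })
    (any? (λ w → (adj G u w Boolₚ.≟ true) ×-dec walk? k w v))

  -- Lengths are tried in increasing order. The second alternative records that all of them failed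
  -- so far, which makes the first success minimal.
  least-walk : ∀ u v k → (∃ λ d → IsDistance G u v d) ⊎ (∀ j → j < k → ¬ Walk G u v j)
  least-walk u v zero = inj₂ (λ _ ())
  least-walk u v (suc k) with least-walk u v k
  ... | inj₁ d = inj₁ d
  ... | inj₂ none with walk? k u v
  ...   | yes p = inj₁ (k , p , λ m q → ℕₚ.≮⇒≥ (λ m<k → none m m<k q))
  ...   | no ¬p = inj₂ none′
    where
    none′ : ∀ j → j < suc k → ¬ Walk G u v j
    none′ j (s≤s j≤k) q with ℕₚ.m≤n⇒m<n∨m≡n j≤k
    ... | inj₁ j<k  = none j j<k q
    ... | inj₂ refl = ¬p q

  distance : Connected G → ∀ u v → ∃ λ d → IsDistance G u v d
  distance conn u v with conn u v
  -- The search must include the length `k` of the known walk, hence `suc k`.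
  ... | k , p with least-walk u v (suc k)
  ...   | inj₁ d    = d
  ...   | inj₂ none = ⊥-elim (none k ℕₚ.≤-refl p)

-- Trees given by parent pointers

-- Unlike `Unique`, this still holds for a cycle written with its first vertex repeated at the end,
-- and it passes to tails.
NonBacktracking : ∀ {A : Set} → List A → Set
NonBacktracking (x ∷ y ∷ z ∷ zs) = x ≢ z × NonBacktracking (y ∷ z ∷ zs)
NonBacktracking _                = ⊤

unique⇒nonBacktracking : ∀ {A : Set} (xs : List A) → Unique xs → NonBacktracking xs
unique⇒nonBacktracking []               _ = tt
unique⇒nonBacktracking (_ ∷ [])         _ = tt
unique⇒nonBacktracking (_ ∷ _ ∷ [])     _ = tt
unique⇒nonBacktracking (x ∷ y ∷ z ∷ zs) ((_ ∷ x≢z ∷ _) ∷ u) = x≢z , unique⇒nonBacktracking (y ∷ z ∷ zs) u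

unique-rotate : ∀ {A : Set} {x : A} xs → Unique (x ∷ xs) → Unique (xs ++ [ x ])
unique-rotate []       _                           = [] ∷ []
unique-rotate (y ∷ xs) ((x≢y ∷ x∉xs) ∷ (y∉xs ∷ u)) = ++⁺ y∉xs ((x≢y ∘ ≡.sym) ∷ []) ∷ unique-rotate xs (x∉xs ∷ u)

module _ (par : Fin n → Fin n) where

  -- Roots and isolated vertices are the fixed points of par.
  ParentEdge : Fin n → Fin n → Set
  ParentEdge u v = u ≢ v × (par u ≡ v ⊎ par v ≡ u)

  parentEdge? : ∀ u v → Dec (ParentEdge u v)
  parentEdge? u v = ¬? (u ≟ v) ×-dec ((par u ≟ v) ⊎-dec (par v ≟ u))

  parentEdge-sym : ∀ {u v} → ParentEdge u v → ParentEdge v u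
  parentEdge-sym (u≢v , e) = u≢v ∘ ≡.sym , swap e

  parentGraph : Graph n
  parentGraph .adj u v  = does (parentEdge? u v)
  parentGraph .sym u v  = does-⇔ (mk⇔ parentEdge-sym parentEdge-sym) (parentEdge? u v) (parentEdge? v u)
  parentGraph .irrefl v = dec-false (parentEdge? v v) (λ e → proj₁ e refl)

  edge⇒adj : ∀ {u v} → ParentEdge u v → Adj parentGraph u v
  edge⇒adj {u} {v} = dec-true (parentEdge? u v)

  adj⇒edge : ∀ {u v} → Adj parentGraph u v → ParentEdge u v
  adj⇒edge {u} {v} = does⇒ (parentEdge? u v)
    where
    does⇒ : ∀ {A : Set} (a? : Dec A) → does a? ≡ true → A
    does⇒ (yes a) _ = a

  -- The rank certifies that following parents never comes back to a vertex once left.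
  module _ (rank : Fin n → ℕ) (rank-par : ∀ w → par w ≢ w → rank (par w) < rank w) where

    rank-< : ∀ {u v} → u ≢ v → par u ≡ v → rank v < rank u
    rank-< u≢v refl = rank-par _ (u≢v ∘ ≡.sym)

    -- A non-backtracking walk that has once moved to a child moves to children for ever.
    descend : ∀ a b xs {e} → Chain parentGraph (a ∷ b ∷ xs ++ [ e ]) → NonBacktracking (a ∷ b ∷ xs ++ [ e ]) →
              par b ≡ a → rank a < rank e
    descend a b [] (ab , be , _) (a≢e , _) pb≡a with adj⇒edge be
    ... | b≢e , inj₁ pb≡e = ⊥-elim (a≢e (trans (≡.sym pb≡a) pb≡e))
    ... | b≢e , inj₂ pe≡b = ℕₚ.<-trans (rank-< (proj₁ (adj⇒edge ab) ∘ ≡.sym) pb≡a) (rank-< (b≢e ∘ ≡.sym) pe≡b)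
    descend a b (c ∷ xs) (ab , bc , ch) (a≢c , nb) pb≡a with adj⇒edge bc
    ... | b≢c , inj₁ pb≡c = ⊥-elim (a≢c (trans (≡.sym pb≡a) pb≡c))
    ... | b≢c , inj₂ pc≡b = ℕₚ.<-trans (rank-< (proj₁ (adj⇒edge ab) ∘ ≡.sym) pb≡a) (descend b c xs (bc , ch) nb pc≡b)

    -- On a non-backtracking walk all moves to parents precede all moves to children. If the last
    -- move is to a child, the parent of `e` is the vertex just before it; otherwise every move is
    -- to a parent and the rank falls throughout.
    last-step : ∀ a b xs {e} → Chain parentGraph (a ∷ b ∷ xs ++ [ e ]) → NonBacktracking (a ∷ b ∷ xs ++ [ e ]) →
                rank e < rank a ⊎ par e ∈ b ∷ xs
    last-step a b [] (ab , be , _) (a≢e , _) with adj⇒edge ab | adj⇒edge be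
    ... | _           | _ , inj₂ pe≡b = inj₂ (here pe≡b)
    ... | a≢b , inj₁ pa≡b | b≢e , inj₁ pb≡e = inj₁ (ℕₚ.<-trans (rank-< b≢e pb≡e) (rank-< a≢b pa≡b))
    ... | _   , inj₂ pb≡a | _   , inj₁ pb≡e = ⊥-elim (a≢e (trans (≡.sym pb≡a) pb≡e))
    last-step a b (c ∷ xs) (ab , bc , ch) (a≢c , nb) with last-step b c xs (bc , ch) nb
    ... | inj₂ pe∈ = inj₂ (there pe∈)
    ... | inj₁ e<b with adj⇒edge ab
    ...   | a≢b , inj₁ pa≡b = inj₁ (ℕₚ.<-trans e<b (rank-< a≢b pa≡b))
    ...   | a≢b , inj₂ pb≡a with adj⇒edge bc
    ...     | _ , inj₁ pb≡c = ⊥-elim (a≢c (trans (≡.sym pb≡a) pb≡c))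
    -- Moving down from `b` to `c` forces a descent all the way to `e`, so `e` would have a larger
    -- rank than `b`.
    ...     | _ , inj₂ pc≡b = ⊥-elim (ℕₚ.<-asym e<b (descend b c xs (bc , ch) nb pc≡b))

    -- If the cycle starts by moving to a child, it descends all the way round and `x` outranks
    -- itself. If it starts at `x` with its parent `y`, the rest is a walk from `y` back to `x`:
    -- either `x` gets a smaller rank than its parent, or `y` occurs a second time.
    parentGraph-acyclic : Acyclic parentGraph
    parentGraph-acyclic (x ∷ y ∷ z ∷ zs) (_ , uniq@((_ ∷ x≢z ∷ _) ∷ y∉ ∷ _) , xy , ch)
      with adj⇒edge xy
    ... | x≢y , inj₂ py≡x = ℕₚ.<-irrefl refl (descend x y (z ∷ zs) (xy , ch) (x≢z , nb) py≡x)
      where nb = unique⇒nonBacktracking (y ∷ z ∷ zs ++ [ x ]) (unique-rotate (y ∷ z ∷ zs) uniq)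
    ... | x≢y , inj₁ px≡y with last-step y z zs ch (unique⇒nonBacktracking (y ∷ z ∷ zs ++ [ x ]) (unique-rotate (y ∷ z ∷ zs) uniq))
    ...   | inj₁ x<y = ℕₚ.<-asym x<y (rank-< x≢y px≡y)
    ...   | inj₂ px∈ = All.lookup y∉ px∈ (≡.sym px≡y)
    parentGraph-acyclic [] ()
    parentGraph-acyclic (_ ∷ []) (() , _)
    parentGraph-acyclic (_ ∷ _ ∷ []) (s≤s () , _)

-- A fixed point of `par` emits no edge, so redirecting fixed points only adds edges. This is how
-- the forest keeps its walks as it grows.
parentGraph-mono : {par par′ : Fin n → Fin n} → (∀ w → par w ≢ w → par′ w ≡ par w) →
                   parentGraph par ⊆ᴳ parentGraph par′
parentGraph-mono {par = par} {par′} agree u v e with adj⇒edge par e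
... | u≢v , inj₁ refl = edge⇒adj par′ (u≢v , inj₁ (agree u (u≢v ∘ ≡.sym)))
... | u≢v , inj₂ refl = edge⇒adj par′ (u≢v , inj₂ (agree v u≢v))

-- Growing the clusters

module _ (G : Graph n) where

  Ball : Fin n → Fin n → Set
  Ball a z = z ≡ a ⊎ Adj G a z

  ball? : ∀ a z → Dec (Ball a z)
  ball? a z = (z ≟ a) ⊎-dec (adj G a z Boolₚ.≟ true)

  degree<∣Ball∣ : ∀ a → suc (degree G a) ≤ count (ball? a)
  degree<∣Ball∣ a = begin
    1 + degree G a                                              ≤⟨ ℕₚ.+-monoˡ-≤ (degree G a) centre≤ ⟩
    count (_≟ a) + degree G a                                   ≡⟨ sum-+ (allFin n) _ _ ⟨
    ∑ (λ z → indicator (z ≟ a) + (if adj G a z then 1 else 0))  ≤⟨ ∑-mono pointwise ⟩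
    count (ball? a)                                             ∎
    where
    open ℕₚ.≤-Reasoning
    centre≤ : 1 ≤ count (_≟ a)
    centre≤ = subst (_≤ count (_≟ a)) (indicator-yes (a ≟ a) refl) (∈⇒≤sum (λ z → indicator (z ≟ a)) (∈-allFin a))
    pointwise : ∀ z → indicator (z ≟ a) + (if adj G a z then 1 else 0) ≤ indicator (ball? a z)
    pointwise z with z ≟ a
    ... | yes refl rewrite irrefl G a = ℕₚ.≤-refl
    ... | no  _ with adj G a z
    ...   | true  = ℕₚ.≤-refl
    ...   | false = z≤n

  -- The invariant of the growth. By `par-covered`, an uncovered vertex is a fixed point of `par` to
  -- which no other vertex points, so it can be attached later without disturbing an edge. `centre`
  -- and `gap` are meaningful on covered vertices only.
  record Clusters (r : Fin n) : Set₁ where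
    field
      Covered  : Fin n → Set
      covered? : ∀ w → Dec (Covered w)
      par      : Fin n → Fin n
      rank     : Fin n → ℕ
      centre   : Fin n → Fin n
      -- distance of the clusters of two covered vertices in the tree of clusters
      gap      : Fin n → Fin n → ℕ

      par-adj     : ∀ w → par w ≢ w → Adj G w (par w)
      par-covered : ∀ w → par w ≢ w → Covered w × Covered (par w)
      rank-par    : ∀ w → par w ≢ w → rank (par w) < rank w

      root-covered : Covered r
      root-centre  : centre r ≡ r

      near-centre  : ∀ {w} → Covered w → Within (parentGraph par) 1 w (centre w)
      -- The next three fields feed the count: the closed neighbourhood in `G` of a centre lies in a
      -- single level of `gap u`, and the levels have no holes.
      ball-covered : ∀ {w z} → Covered w → Ball (centre w) z → Covered z
      ball-gap     : ∀ {u w z} → Covered u → Covered w → Ball (centre w) z → gap u z ≡ gap u w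
      gap-pred     : ∀ {u w k} → Covered u → Covered w → gap u w ≡ suc k → ∃ λ w′ → Covered w′ × gap u w′ ≡ k
      -- The centres of adjacent clusters are joined by at most three edges, whence the factor 3.
      gap-walk     : ∀ {u w} → Covered u → Covered w → Within (parentGraph par) (3 * gap u w) (centre u) (centre w)

  module Initial (r : Fin n) where

    par : Fin n → Fin n
    par w = if does (ball? r w) then r else w

    par-ball : ∀ {w} → Ball r w → par w ≡ r
    par-ball {w} b = cong (λ t → if t then r else w) (dec-true (ball? r w) b)

    moved⇒adj : ∀ w → par w ≢ w → Adj G r w
    moved⇒adj w ne with ball? r w
    ... | yes (inj₁ refl) = ⊥-elim (ne (par-ball (inj₁ refl)))
    ... | yes (inj₂ e)    = e
    ... | no ¬b           = ⊥-elim (ne (cong (λ t → if t then r else w) (dec-false (ball? r w) ¬b)))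

    par-moved : ∀ w → par w ≢ w → par w ≡ r
    par-moved w ne = par-ball (inj₂ (moved⇒adj w ne))

    rank : Fin n → ℕ
    rank w = indicator (¬? (w ≟ r))

    rank-par : ∀ w → par w ≢ w → rank (par w) < rank w
    rank-par w ne
      rewrite par-moved w ne
            | indicator-no (¬? (r ≟ r)) (λ r≢r → r≢r refl)
            | indicator-yes (¬? (w ≟ r)) (adj⇒≢ G (adj-sym G (moved⇒adj w ne))) = s≤s z≤n

    near-centre : ∀ {w} → Ball r w → Within (parentGraph par) 1 w r
    near-centre (inj₁ refl) = within-refl
    near-centre (inj₂ e)    = within-edge (edge⇒adj par (adj⇒≢ G (adj-sym G e) , inj₁ (par-ball (inj₂ e))))

    initial : Clusters r
    initial = record
      { Covered      = Ball r
      ; covered?     = ball? r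
      ; par          = par
      ; rank         = rank
      ; centre       = λ _ → r
      ; gap          = λ _ _ → 0
      ; par-adj      = λ w ne → subst (Adj G w) (≡.sym (par-moved w ne)) (adj-sym G (moved⇒adj w ne))
      ; par-covered  = λ w ne → inj₂ (moved⇒adj w ne) , inj₁ (par-moved w ne)
      ; rank-par     = rank-par
      ; root-covered = inj₁ refl
      ; root-centre  = refl
      ; near-centre  = near-centre
      ; ball-covered = λ _ b → b
      ; ball-gap     = λ _ _ _ → refl
      ; gap-pred     = λ _ _ ()
      ; gap-walk     = λ _ _ → within-refl
      }

  -- A new star with centre a, joined to the covered vertex y by its vertex x: the
  -- star hangs from x, so that x is the parent of a.
  module Extend {r : Fin n} (C : Clusters r) {a x y : Fin n}
    (far : ∀ {z} → Ball a z → ¬ Clusters.Covered C z)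
    (ax : Adj G a x) (xy : Adj G x y) (y∈ : Clusters.Covered C y) where

    open Clusters C

    -- The cases are the ways of choosing a parent. The vertex `x` also lies in the ball of `a`, but
    -- must hang from `y` and not from `a`, so `link` is tested first.
    data Position (z : Fin n) : Set where
      link    : z ≡ x → Position z
      hub     : z ≡ a → Position z
      rim     : Adj G a z → z ≢ x → Position z
      outside : ¬ Ball a z → Position z

    position : ∀ z → Position z
    position z with z ≟ x | ball? a z
    ... | yes z≡x | _               = link z≡x
    ... | no  _   | yes (inj₁ z≡a)  = hub z≡a
    ... | no  z≢x | yes (inj₂ az)   = rim az z≢x
    ... | no  _   | no  ¬b          = outside ¬b

    -- Parent and rank are chosen together: ranks go up by one along `y`, `x`, `a`, rim. With the
    -- position as an argument, the field proofs can match on it directly.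
    placeOf : ∀ {z} → Position z → Fin n × ℕ
    placeOf (link _)        = y , 1 + rank y
    placeOf (hub _)         = x , 2 + rank y
    placeOf (rim _ _)       = a , 3 + rank y
    placeOf {z} (outside _) = par z , rank z

    place : Fin n → Fin n × ℕ
    place z = placeOf (position z)

    par′ : Fin n → Fin n
    par′ z = proj₁ (place z)

    rank′ : Fin n → ℕ
    rank′ z = proj₂ (place z)

    a≢x : a ≢ x
    a≢x = adj⇒≢ G ax

    place-link : place x ≡ (y , 1 + rank y)
    place-link with position x
    ... | link _     = refl
    ... | hub x≡a    = ⊥-elim (a≢x (≡.sym x≡a))
    ... | rim _ x≢x  = ⊥-elim (x≢x refl)
    ... | outside ¬b = ⊥-elim (¬b (inj₂ ax))

    place-hub : place a ≡ (x , 2 + rank y)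
    place-hub with position a
    ... | link a≡x   = ⊥-elim (a≢x a≡x)
    ... | hub _      = refl
    ... | rim aa _   = ⊥-elim (adj⇒≢ G aa refl)
    ... | outside ¬b = ⊥-elim (¬b (inj₁ refl))

    place-rim : ∀ {z} → Adj G a z → z ≢ x → place z ≡ (a , 3 + rank y)
    place-rim {z} az z≢x with position z
    ... | link z≡x   = ⊥-elim (z≢x z≡x)
    ... | hub z≡a    = ⊥-elim (adj⇒≢ G az (≡.sym z≡a))
    ... | rim _ _    = refl
    ... | outside ¬b = ⊥-elim (¬b (inj₂ az))

    place-covered : ∀ {z} → Covered z → place z ≡ (par z , rank z)
    place-covered {z} c with position z
    ... | link refl  = ⊥-elim (far (inj₂ ax) c)
    ... | hub refl   = ⊥-elim (far (inj₁ refl) c)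
    ... | rim az _   = ⊥-elim (far (inj₂ az) c)
    ... | outside _  = refl

    Covered′ : Fin n → Set
    Covered′ z = Ball a z ⊎ Covered z

    par-adj′ : ∀ {w} (p : Position w) → proj₁ (placeOf p) ≢ w → Adj G w (proj₁ (placeOf p))
    par-adj′ (link refl)  _  = xy
    par-adj′ (hub refl)   _  = ax
    par-adj′ (rim aw _)   _  = adj-sym G aw
    par-adj′ (outside _)  ne = par-adj _ ne

    par-covered′ : ∀ {w} (p : Position w) → proj₁ (placeOf p) ≢ w → Covered′ w × Covered′ (proj₁ (placeOf p))
    par-covered′ (link refl) _  = inj₁ (inj₂ ax) , inj₂ y∈
    par-covered′ (hub refl)  _  = inj₁ (inj₁ refl) , inj₁ (inj₂ ax)
    par-covered′ (rim aw _)  _  = inj₁ (inj₂ aw) , inj₁ (inj₁ refl)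
    par-covered′ (outside _) ne = inj₂ (proj₁ (par-covered _ ne)) , inj₂ (proj₂ (par-covered _ ne))

    rank-par′ : ∀ {w} (p : Position w) → proj₁ (placeOf p) ≢ w → rank′ (proj₁ (placeOf p)) < proj₂ (placeOf p)
    rank-par′ (link _)    _  = s≤s (ℕₚ.≤-reflexive (cong proj₂ (place-covered y∈)))
    rank-par′ (hub _)     _  = s≤s (ℕₚ.≤-reflexive (cong proj₂ place-link))
    rank-par′ (rim _ _)   _  = s≤s (ℕₚ.≤-reflexive (cong proj₂ place-hub))
    rank-par′ {w} (outside _) ne =
      subst (_< rank w) (≡.sym (cong proj₂ (place-covered (proj₂ (par-covered w ne))))) (rank-par w ne)

    T T′ : Graph n
    T  = parentGraph par
    T′ = parentGraph par′

    lift : ∀ {k u v} → Within T k u v → Within T′ k u v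
    lift = within-mono {S = T} {T = T′}
      (parentGraph-mono (λ w ne → cong proj₁ (place-covered (proj₁ (par-covered w ne)))))

    edge-ax : Adj T′ a x
    edge-ax = edge⇒adj par′ (a≢x , inj₁ (cong proj₁ place-hub))

    edge-xy : Adj T′ x y
    edge-xy = edge⇒adj par′ (adj⇒≢ G xy , inj₁ (cong proj₁ place-link))

    near-hub : ∀ {z} → Ball a z → Within T′ 1 z a
    near-hub (inj₁ refl) = within-refl
    near-hub {z} (inj₂ az) with z ≟ x
    ... | yes refl = within-sym (within-edge edge-ax)
    ... | no  z≢x  = within-edge (edge⇒adj par′ (adj⇒≢ G (adj-sym G az) , inj₁ (cong proj₁ (place-rim az z≢x))))

    -- The route is `a`, `x`, `y`, `centre y`, where the last edge may degenerate.
    hub-to-centre : Within T′ 3 a (centre y)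
    hub-to-centre = within-trans (within-edge edge-ax) (within-trans (within-edge edge-xy) (lift (near-centre y∈)))

    centre′ : Fin n → Fin n
    centre′ z = if does (ball? a z) then a else centre z

    -- The new cluster becomes a leaf of the tree of clusters, attached to the cluster of `y`: old
    -- distances persist, and new ones are one more than those from `y`.
    gap′ : Fin n → Fin n → ℕ
    gap′ u w = if does (ball? a u)
               then (if does (ball? a w) then 0 else suc (gap y w))
               else (if does (ball? a w) then suc (gap u y) else gap u w)

    new : ∀ {z} → Ball a z → does (ball? a z) ≡ true
    new {z} = dec-true (ball? a z)

    old : ∀ {z} → Covered z → does (ball? a z) ≡ false
    old {z} c = dec-false (ball? a z) (λ b → far b c)

    centre-new : ∀ {z} → Ball a z → centre′ z ≡ a
    centre-new b rewrite new b = refl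

    centre-old : ∀ {z} → Covered z → centre′ z ≡ centre z
    centre-old c rewrite old c = refl

    gap-new-new : ∀ {u w} → Ball a u → Ball a w → gap′ u w ≡ 0
    gap-new-new u∈ w∈ rewrite new u∈ | new w∈ = refl

    gap-new-old : ∀ {u w} → Ball a u → Covered w → gap′ u w ≡ suc (gap y w)
    gap-new-old u∈ w∈ rewrite new u∈ | old w∈ = refl

    gap-old-new : ∀ {u w} → Covered u → Ball a w → gap′ u w ≡ suc (gap u y)
    gap-old-new u∈ w∈ rewrite old u∈ | new w∈ = refl

    gap-old-old : ∀ {u w} → Covered u → Covered w → gap′ u w ≡ gap u w
    gap-old-old u∈ w∈ rewrite old u∈ | old w∈ = refl

    near-centre′ : ∀ {w} → Covered′ w → Within T′ 1 w (centre′ w)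
    near-centre′ {w} (inj₁ b) = subst (Within T′ 1 w) (≡.sym (centre-new b)) (near-hub b)
    near-centre′ {w} (inj₂ c) = subst (Within T′ 1 w) (≡.sym (centre-old c)) (lift (near-centre c))

    ball-new : ∀ {w z} → Ball a w → Ball (centre′ w) z → Ball a z
    ball-new {z = z} w∈ = subst (λ t → Ball t z) (centre-new w∈)

    ball-old : ∀ {w z} → Covered w → Ball (centre′ w) z → Ball (centre w) z
    ball-old {z = z} w∈ = subst (λ t → Ball t z) (centre-old w∈)

    ball-covered′ : ∀ {w z} → Covered′ w → Ball (centre′ w) z → Covered′ z
    ball-covered′ (inj₁ w∈) b = inj₁ (ball-new w∈ b)
    ball-covered′ (inj₂ w∈) b = inj₂ (ball-covered w∈ (ball-old w∈ b))

    ball-gap′ : ∀ {u w z} → Covered′ u → Covered′ w → Ball (centre′ w) z → gap′ u z ≡ gap′ u w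
    ball-gap′ (inj₁ u∈) (inj₁ w∈) b = trans (gap-new-new u∈ (ball-new w∈ b)) (≡.sym (gap-new-new u∈ w∈))
    ball-gap′ (inj₂ u∈) (inj₁ w∈) b = trans (gap-old-new u∈ (ball-new w∈ b)) (≡.sym (gap-old-new u∈ w∈))
    ball-gap′ (inj₁ u∈) (inj₂ w∈) b =
      trans (gap-new-old u∈ (ball-covered w∈ b′)) (trans (cong suc (ball-gap y∈ w∈ b′)) (≡.sym (gap-new-old u∈ w∈)))
      where b′ = ball-old w∈ b
    ball-gap′ (inj₂ u∈) (inj₂ w∈) b =
      trans (gap-old-old u∈ (ball-covered w∈ b′)) (trans (ball-gap u∈ w∈ b′) (≡.sym (gap-old-old u∈ w∈)))
      where b′ = ball-old w∈ b

    gap-pred′ : ∀ {u w k} → Covered′ u → Covered′ w → gap′ u w ≡ suc k → ∃ λ w′ → Covered′ w′ × gap′ u w′ ≡ k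
    gap-pred′ (inj₁ u∈) (inj₁ w∈) eq with trans (≡.sym (gap-new-new u∈ w∈)) eq
    ... | ()
    -- At gap one the predecessor is the new cluster itself, represented by `a`.
    gap-pred′ {k = zero} (inj₁ u∈) (inj₂ w∈) eq = a , inj₁ (inj₁ refl) , gap-new-new u∈ (inj₁ refl)
    gap-pred′ {k = suc k} (inj₁ u∈) (inj₂ w∈) eq
      with gap-pred y∈ w∈ (ℕₚ.suc-injective (trans (≡.sym (gap-new-old u∈ w∈)) eq))
    ... | w′ , w′∈ , eq′ = w′ , inj₂ w′∈ , trans (gap-new-old u∈ w′∈) (cong suc eq′)
    -- The only neighbour of the new cluster is that of `y`, which therefore lies one level lower.
    gap-pred′ (inj₂ u∈) (inj₁ w∈) eq =
      y , inj₂ y∈ , trans (gap-old-old u∈ y∈) (ℕₚ.suc-injective (trans (≡.sym (gap-old-new u∈ w∈)) eq))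
    gap-pred′ (inj₂ u∈) (inj₂ w∈) eq with gap-pred u∈ w∈ (trans (≡.sym (gap-old-old u∈ w∈)) eq)
    ... | w′ , w′∈ , eq′ = w′ , inj₂ w′∈ , trans (gap-old-old u∈ w′∈) eq′

    gap-walk′ : ∀ {u w} → Covered′ u → Covered′ w → Within T′ (3 * gap′ u w) (centre′ u) (centre′ w)
    gap-walk′ (inj₁ u∈) (inj₁ w∈)
      rewrite centre-new u∈ | centre-new w∈ = within-refl
    gap-walk′ {u} {w} (inj₁ u∈) (inj₂ w∈)
      rewrite centre-new u∈ | centre-old w∈ | gap-new-old u∈ w∈ | ℕₚ.*-suc 3 (gap y w) =
      within-trans hub-to-centre (lift (gap-walk y∈ w∈))
    gap-walk′ {u} {w} (inj₂ u∈) (inj₁ w∈)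
      rewrite centre-old u∈ | centre-new w∈ | gap-old-new u∈ w∈ | ℕₚ.*-suc 3 (gap u y) | ℕₚ.+-comm 3 (3 * gap u y) =
      within-trans (lift (gap-walk u∈ y∈)) (within-sym hub-to-centre)
    gap-walk′ (inj₂ u∈) (inj₂ w∈)
      rewrite centre-old u∈ | centre-old w∈ | gap-old-old u∈ w∈ = lift (gap-walk u∈ w∈)

    extend : Clusters r
    extend = record
      { Covered      = Covered′
      ; covered?     = λ z → ball? a z ⊎-dec covered? z
      ; par          = par′
      ; rank         = rank′
      ; centre       = centre′
      ; gap          = gap′
      ; par-adj      = λ w → par-adj′ (position w)
      ; par-covered  = λ w → par-covered′ (position w)
      ; rank-par     = λ w → rank-par′ (position w)
      ; root-covered = inj₂ root-covered
      ; root-centre  = trans (centre-old root-covered) root-centre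
      ; near-centre  = near-centre′
      ; ball-covered = ball-covered′
      ; ball-gap     = ball-gap′
      ; gap-pred     = gap-pred′
      ; gap-walk     = gap-walk′
      }

  -- Extending until the clusters dominate

  uncovered : ∀ {r} → Clusters r → ℕ
  uncovered C = count (λ w → ¬? (Clusters.covered? C w))

  -- These are the vertices whose closed neighbourhood avoids the covered set, hence the candidates
  -- for a new centre.
  Isolated : ∀ {r} → Clusters r → Fin n → Set
  Isolated C w = ¬ Covered w × ¬ ∃ λ z → Covered z × Adj G w z
    where open Clusters C

  isolated? : ∀ {r} (C : Clusters r) w → Dec (Isolated C w)
  isolated? C w = ¬? (covered? w) ×-dec ¬? (any? (λ z → covered? z ×-dec (adj G w z Boolₚ.≟ true)))
    where open Clusters C

  Dominating : ∀ {r} → Clusters r → Set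
  Dominating C = ∀ w → ¬ Covered w → ∃ λ z → Covered z × Adj G w z
    where open Clusters C

  -- Follow the walk towards `r` until the next vertex `x` is not isolated. As a neighbour of an
  -- isolated vertex, `x` is uncovered, so it must have a covered neighbour `y`.
  boundary : ∀ {r} (C : Clusters r) {w k} → Walk G w r k → Isolated C w →
             ∃ λ a → ∃ λ x → ∃ λ y → Isolated C a × Adj G a x × Adj G x y × Clusters.Covered C y
  boundary C here (r∉ , _) = ⊥-elim (r∉ (Clusters.root-covered C))
  boundary C {w} (step {w = x} e p) iso with isolated? C x
  ... | yes iso′ = boundary C p iso′
  ... | no ¬iso with any? (λ z → Clusters.covered? C z ×-dec (adj G x z Boolₚ.≟ true))
  ...   | yes (y , y∈ , xy) = w , x , y , iso , e , xy , y∈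
  ...   | no none = ⊥-elim (¬iso ((λ x∈ → proj₂ iso (x , x∈ , e)) , none))

  -- `k` is fuel exceeding the number of uncovered vertices, and each extension covers at least its
  -- new centre `a`.
  grow : Connected G → ∀ {r} k (C : Clusters r) → uncovered C < k → Σ (Clusters r) Dominating
  grow conn zero    C ()
  grow conn {r} (suc k) C (s≤s C≤k) with any? (isolated? C)
  ... | no none = C , dominating
    where
    open Clusters C
    dominating : Dominating C
    dominating w w∉ with any? (λ z → covered? z ×-dec (adj G w z Boolₚ.≟ true))
    ... | yes z  = z
    ... | no  ¬z = ⊥-elim (none (w , w∉ , ¬z))
  ... | yes (w , iso) with boundary C (proj₂ (conn w r)) iso
  ...   | a , x , y , (a∉ , a-far) , ax , xy , y∈ = grow conn k extend (ℕₚ.<-≤-trans smaller C≤k)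
    where
    open Clusters C
    far : ∀ {z} → Ball a z → ¬ Covered z
    far (inj₁ refl) = a∉
    far (inj₂ e) z∈ = a-far (_ , z∈ , e)
    open Extend C far ax xy y∈
    smaller : uncovered extend < uncovered C
    smaller = sum-mono-< {x = a}
      (λ z → indicator-mono (¬? (Clusters.covered? extend z)) (¬? (covered? z)) (λ ∉′ ∈ → ∉′ (inj₂ ∈)))
      (∈-allFin a)
      (subst₂ _<_ (≡.sym (indicator-no (¬? (Clusters.covered? extend a)) (λ ∉′ → ∉′ (inj₁ (inj₁ refl)))))
                  (≡.sym (indicator-yes (¬? (covered? a)) a∉)) (s≤s z≤n))

  -- Attaching the remaining vertices as leaves

  module Span {r : Fin n} (C : Clusters r) (dom : Dominating C) where

    open Clusters C

    -- The anchor is the covered vertex from which an uncovered one hangs. Through it, notions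
    -- meaningful only on covered vertices extend to all vertices.
    anchorOf : ∀ w → Dec (Covered w) → Fin n
    anchorOf w (yes _) = w
    anchorOf w (no w∉) = proj₁ (dom w w∉)

    anchor : Fin n → Fin n
    anchor w = anchorOf w (covered? w)

    anchor-covered : ∀ w → Covered (anchor w)
    anchor-covered w with covered? w
    ... | yes w∈ = w∈
    ... | no  w∉ = proj₁ (proj₂ (dom w w∉))

    anchor-fixed : ∀ {w} → Covered w → anchor w ≡ w
    anchor-fixed {w} w∈ with covered? w
    ... | yes _  = refl
    ... | no  w∉ = ⊥-elim (w∉ w∈)

    placeOf : ∀ w → Dec (Covered w) → Fin n × ℕ
    placeOf w (yes _) = par w , rank w
    placeOf w (no w∉) = anchorOf w (no w∉) , suc (rank (anchorOf w (no w∉)))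

    place : Fin n → Fin n × ℕ
    place w = placeOf w (covered? w)

    par′ : Fin n → Fin n
    par′ w = proj₁ (place w)

    rank′ : Fin n → ℕ
    rank′ w = proj₂ (place w)

    place-covered : ∀ {w} → Covered w → place w ≡ (par w , rank w)
    place-covered {w} w∈ with covered? w
    ... | yes _  = refl
    ... | no  w∉ = ⊥-elim (w∉ w∈)

    par-adj′ : ∀ {w} d → proj₁ (placeOf w d) ≢ w → Adj G w (proj₁ (placeOf w d))
    par-adj′ (yes _) ne = par-adj _ ne
    par-adj′ (no w∉) _  = proj₂ (proj₂ (dom _ w∉))

    rank-par′ : ∀ {w} d → proj₁ (placeOf w d) ≢ w → rank′ (proj₁ (placeOf w d)) < proj₂ (placeOf w d)
    rank-par′ {w} (yes _) ne =
      subst (_< rank w) (≡.sym (cong proj₂ (place-covered (proj₂ (par-covered w ne))))) (rank-par w ne)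
    rank-par′ {w} (no w∉) _ = s≤s (ℕₚ.≤-reflexive (cong proj₂ (place-covered (proj₁ (proj₂ (dom w w∉))))))

    T : Graph n
    T = parentGraph par′

    lift : ∀ {k u v} → Within (parentGraph par) k u v → Within T k u v
    lift = within-mono {S = parentGraph par} {T = T}
      (parentGraph-mono (λ w ne → cong proj₁ (place-covered (proj₁ (par-covered w ne)))))

    near-anchor : ∀ w → Within T 1 w (anchor w)
    near-anchor w with covered? w in eq
    ... | yes _  = within-refl
    ... | no  w∉ = within-edge (edge⇒adj par′
                     (adj⇒≢ G (proj₂ (proj₂ (dom w w∉))) , inj₁ (cong (proj₁ ∘ placeOf w) eq)))

    near-centre′ : ∀ w → Within T 2 w (centre (anchor w))
    near-centre′ w = within-trans (near-anchor w) (lift (near-centre (anchor-covered w)))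

    level : Fin n → Fin n → ℕ
    level u w = gap (anchor u) (anchor w)

    -- Two edges at each end, from the vertex to its anchor and on to the centre, give the 4;
    -- `gap-walk` joins the centres.
    near : ∀ u w → Within T (4 + 3 * level u w) u w
    near u w = subst (λ k → Within T k u w) (cong (_+_ 2) (ℕₚ.+-comm (3 * level u w) 2))
      (within-trans (near-centre′ u)
        (within-trans (lift (gap-walk (anchor-covered u) (anchor-covered w))) (within-sym (near-centre′ w))))

    connected : Connected T
    connected u w with near u w
    ... | k , _ , p = k , p

    subgraph : T ⊆ᴳ G
    subgraph u v e with adj⇒edge par′ e
    ... | u≢v , inj₁ refl = par-adj′ (covered? u) (u≢v ∘ ≡.sym)
    ... | u≢v , inj₂ refl = adj-sym G (par-adj′ (covered? v) u≢v)

    spanningTree : IsSpanningTree T G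
    spanningTree = subgraph , connected , parentGraph-acyclic par′ rank′ (λ w → rank-par′ (covered? w))

    level-pred : ∀ u {w k} → level u w ≡ suc k → ∃ λ w′ → level u w′ ≡ k
    level-pred u {w} eq with gap-pred (anchor-covered u) (anchor-covered w) eq
    ... | w′ , w′∈ , eq′ = w′ , trans (cong (gap (anchor u)) (anchor-fixed w′∈)) eq′

    -- The whole ball of the centre shares the level of `w` by `ball-gap`; its vertices are covered,
    -- hence their own anchors.
    level-large : ∀ u w → suc (degree G (centre (anchor w))) ≤ count (λ z → level u z ℕₚ.≟ level u w)
    level-large u w = ℕₚ.≤-trans (degree<∣Ball∣ c)
      (∑-mono (λ z → indicator-mono (ball? c z) (level u z ℕₚ.≟ level u w) (same-level z)))
      where
      c = centre (anchor w)
      same-level : ∀ z → Ball c z → level u z ≡ level u w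
      same-level z b = trans (cong (gap (anchor u)) (anchor-fixed (ball-covered (anchor-covered w) b)))
                             (ball-gap (anchor-covered u) (anchor-covered w) b)

    -- The cluster of `r` is centred at `r`, so its level profits from the degree of `r`, later
    -- chosen maximum.
    root-level-large : ∀ u → suc (degree G r) ≤ count (λ z → level u z ℕₚ.≟ level u r)
    root-level-large u =
      subst (λ c → suc (degree G c) ≤ count (λ z → level u z ℕₚ.≟ level u r))
            (trans (cong centre (anchor-fixed root-covered)) root-centre) (level-large u r)

    dist : Fin n → Fin n → ℕ
    dist u w = proj₁ (distance T connected u w)

    dist-isDistance : ∀ u w → IsDistance T u w (dist u w)
    dist-isDistance u w = proj₂ (distance T connected u w)

    dist-level : ∀ u w → dist u w ≤ 4 + 3 * level u w
    dist-level u w = distance-within (dist-isDistance u w) (near u w)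

    totalDist-level : ∀ u → totalDist dist u ≤ n * 4 + 3 * ∑ (level u)
    totalDist-level u = begin
      totalDist dist u                           ≤⟨ ∑-mono (dist-level u) ⟩
      ∑ (λ w → 4 + 3 * level u w)                ≡⟨ sum-+ (allFin n) (λ _ → 4) _ ⟩
      ∑ {n} (λ _ → 4) + ∑ (λ w → 3 * level u w)  ≡⟨ cong₂ _+_ (∑-const n 4) (sum-* (allFin n) 3 (level u)) ⟩
      n * 4 + 3 * ∑ (level u)                    ∎
      where open ℕₚ.≤-Reasoning

    ∑level-bound : ∀ {δ} → (∀ v → δ ≤ degree G v) → ∀ u →
                   2 * (suc δ * ∑ (level u)) + suc (degree G r) * suc (degree G r) ≤ n * n
    ∑level-bound {δ} δ≤ u =
      Levels.level-bound (level u) (suc δ) (level-pred u) (λ w → ℕₚ.≤-trans (s≤s (δ≤ _)) (level-large u w))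
        r (root-level-large u)

-- The numerical bound

-- The bound is multiplied out and Δ² moved to the left, so that no subtraction occurs.
total-bound : ∀ m t F δ Δ → δ ≤ Δ → t ≤ (2 + m) * 4 + 3 * F →
              2 * (suc δ * F) + suc Δ * suc Δ ≤ (2 + m) * (2 + m) →
              t * (2 * suc δ) + 3 * (Δ * Δ) ≤ 3 * ((2 + m) * (2 + m)) + 7 * (2 * (1 + m) * suc δ)
total-bound m t F δ Δ δ≤Δ t≤ F≤ with ℕₚ.m≤n⇒∃[o]m+o≡n δ≤Δ
-- Adding `3 * (2 * Δ + 1)` to both sides completes `3 * (Δ * Δ)` to `3 * (suc Δ * suc Δ)`, as in
-- the hypothesis on `F`.
... | e , refl = ℕₚ.+-cancelʳ-≤ (3 * (2 * Δ + 1)) _ _ (begin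
    t * (2 * suc δ) + 3 * (Δ * Δ) + 3 * (2 * Δ + 1)
      ≤⟨ ℕₚ.+-monoˡ-≤ _ (ℕₚ.+-monoˡ-≤ _ (ℕₚ.*-monoˡ-≤ (2 * suc δ) t≤)) ⟩
    ((2 + m) * 4 + 3 * F) * (2 * suc δ) + 3 * (Δ * Δ) + 3 * (2 * Δ + 1)
      ≡⟨ collect m F δ Δ ⟩
    3 * (2 * (suc δ * F) + suc Δ * suc Δ) + (2 + m) * 4 * (2 * suc δ)
      -- The term added is the exact slack, with `Δ` equal to `δ + e`. For order 2 the constant 7
      -- alone falls short of 4n/(n-1) = 8, and the surplus `3 * (2 * Δ + 1)` makes up for it.
      ≤⟨ ℕₚ.+-mono-≤ (ℕₚ.*-monoʳ-≤ 3 F≤) (ℕₚ.m≤m+n _ (4 * δ + 6 * e + 1 + 6 * m * suc δ)) ⟩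
    3 * ((2 + m) * (2 + m)) + ((2 + m) * 4 * (2 * suc δ) + (4 * δ + 6 * e + 1 + 6 * m * suc δ))
      ≡⟨ slack m δ e ⟩
    3 * ((2 + m) * (2 + m)) + 7 * (2 * (1 + m) * suc δ) + 3 * (2 * Δ + 1) ∎)
  where
  open ℕₚ.≤-Reasoning
  collect : ∀ m F δ Δ → ((2 + m) * 4 + 3 * F) * (2 * suc δ) + 3 * (Δ * Δ) + 3 * (2 * Δ + 1) ≡
                        3 * (2 * (suc δ * F) + suc Δ * suc Δ) + (2 + m) * 4 * (2 * suc δ)
  collect = solve-∀
  slack : ∀ m δ e → 3 * ((2 + m) * (2 + m)) + ((2 + m) * 4 * (2 * suc δ) + (4 * δ + 6 * e + 1 + 6 * m * suc δ)) ≡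
                    3 * ((2 + m) * (2 + m)) + 7 * (2 * (1 + m) * suc δ) + 3 * (2 * (δ + e) + 1)
  slack = solve-∀

-- In the unnormalised rationals sums and comparisons are plain cross-multiplications, so the claim
-- becomes an inequality of integers.
average-bound : ∀ m t δ Δ →
  t * (2 * suc δ) + 3 * (Δ * Δ) ≤ 3 * ((2 + m) * (2 + m)) + 7 * (2 * (1 + m) * suc δ) →
  ((+ t) ℚ./ suc m) ≤ℚ bound (2 + m) (s≤s (s≤s z≤n)) δ Δ
average-bound m t δ Δ t≤ = ℚₚ.toℚᵘ-cancel-≤ (begin
  toℚᵘ ((+ t) ℚ./ suc m)                            ≃⟨ ℚₚ.toℚᵘ-fromℚᵘ (mkℚᵘ (+ t) m) ⟩
  mkℚᵘ (+ t) m                                      ≤⟨ *≤* cleared ⟩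
  mkℚᵘ A d ℚᵘ.+ mkℚᵘ (+ 7) 0                        ≃⟨ ℚᵘₚ.+-cong (ℚₚ.toℚᵘ-fromℚᵘ (mkℚᵘ A d)) (ℚₚ.toℚᵘ-fromℚᵘ (mkℚᵘ (+ 7) 0)) ⟨
  toℚᵘ (A ℚ./ suc d) ℚᵘ.+ toℚᵘ ((+ 7) ℚ./ 1)        ≃⟨ ℚₚ.toℚᵘ-homo-+ (A ℚ./ suc d) ((+ 7) ℚ./ 1) ⟨
  toℚᵘ (bound (2 + m) (s≤s (s≤s z≤n)) δ Δ)          ∎)
  where
  open ℚᵘₚ.≤-Reasoning
  N = 2 + m
  D = suc δ
  A = + 3 ℤ.* (+ (N * N) ℤ.- + (Δ * Δ))
  -- `mkℚᵘ` stores the denominator minus one, so `suc d` is the denominator of the bound.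
  d = ℕ.pred (2 * suc m * D)

  t≤ℤ : + t ℤ.* + (2 * D) ℤ.+ + 3 ℤ.* + (Δ * Δ) ℤ.≤ + 3 ℤ.* + (N * N) ℤ.+ + 7 ℤ.* + suc d
  t≤ℤ = subst₂ ℤ._≤_
    (cong₂ ℤ._+_ (ℤₚ.pos-* t (2 * D)) (ℤₚ.pos-* 3 (Δ * Δ)))
    (cong₂ ℤ._+_ (ℤₚ.pos-* 3 (N * N)) (ℤₚ.pos-* 7 (suc d)))
    (ℤ.+≤+ t≤)

  -- The term with `Δ * Δ` returns to the right, now with true subtraction. The factor `+ 1` is the
  -- denominator of 7 in the sum of fractions.
  A≥ : + t ℤ.* + (2 * D) ℤ.≤ A ℤ.* + 1 ℤ.+ + 7 ℤ.* + suc d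
  A≥ = subst₂ ℤ._≤_ (cancel (+ t ℤ.* + (2 * D)) (+ (Δ * Δ))) (shift (+ (N * N)) (+ (Δ * Δ)) (+ suc d))
         (ℤₚ.+-monoˡ-≤ (ℤ.- (+ 3 ℤ.* + (Δ * Δ))) t≤ℤ)
    where
    cancel : ∀ a b → a ℤ.+ + 3 ℤ.* b ℤ.+ ℤ.- (+ 3 ℤ.* b) ≡ a
    cancel = ℤ-Solver.solve-∀
    shift : ∀ a b c → + 3 ℤ.* a ℤ.+ + 7 ℤ.* c ℤ.+ ℤ.- (+ 3 ℤ.* b) ≡ + 3 ℤ.* (a ℤ.- b) ℤ.* + 1 ℤ.+ + 7 ℤ.* c
    shift = ℤ-Solver.solve-∀

  -- Multiplying `A≥` by `suc m`, which is n-1, completes `2 * D` to the denominator that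
  -- cross-multiplication produces.
  denominator : + t ℤ.* + (2 * D) ℤ.* + suc m ≡ + t ℤ.* (+ suc d ℤ.* + 1)
  denominator = trans (ℤₚ.*-assoc (+ t) (+ (2 * D)) (+ suc m))
    (cong (ℤ._*_ (+ t)) (trans (≡.sym (ℤₚ.pos-* (2 * D) (suc m)))
      (trans (cong +_ (reorder D (suc m))) (≡.sym (ℤₚ.*-identityʳ (+ suc d))))))
    where
    reorder : ∀ a b → 2 * a * b ≡ 2 * b * a
    reorder = solve-∀

  cleared : + t ℤ.* (+ suc d ℤ.* + 1) ℤ.≤ (A ℤ.* + 1 ℤ.+ + 7 ℤ.* + suc d) ℤ.* + suc m
  cleared = subst (ℤ._≤ (A ℤ.* + 1 ℤ.+ + 7 ℤ.* + suc d) ℤ.* + suc m) denominator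
              (ℤₚ.*-monoʳ-≤-nonNeg (+ suc m) A≥)

theorem3p2 : ∀ {n : ℕ} (h : 2 ≤ n) (G : Graph n) → Connected G →
    ∀ (δ Δ : ℕ) → IsMinDegree G δ → IsMaxDegree G Δ →
    Σ (Graph n) λ T → IsSpanningTree T G ×
    Σ (Fin n → Fin n → ℕ) λ d →
    (∀ u v → IsDistance T u v (d u v)) ×
    (∀ v → avgDist h d v ≤ℚ bound n h δ Δ)
-- Matching on `refl` replaces `Δ` by `degree G r`, and this `r` becomes the first centre.
theorem3p2 {suc (suc m)} (s≤s (s≤s z≤n)) G conn δ _ (δ≤ , _) (_ , r , refl)
  with grow G conn _ (Initial.initial G r) ℕₚ.≤-refl
... | C , dom = T , spanningTree , dist , dist-isDistance ,
  λ v → average-bound m (totalDist dist v) δ (degree G r)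
    (total-bound m (totalDist dist v) (∑ (level v)) δ (degree G r) (δ≤ r) (totalDist-level v) (∑level-bound δ≤ v))
  where open Span G C dom
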